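{- For all $n\ge1$, $$H_n\left(\frac{E_k(1)}{k!}\right)=\frac{(2n+2)!}{(n+1)!}\cdot H_n\left(\frac{E_{k+1}(1)}{(k+1)!}\right),$$ where $E_j(x)$ are the Euler polynomials.
   Context: For a sequence $(a_k)_{k\ge 0}$ and $n\ge 0$, $H_n(a_k):=\det(a_{i+j})_{0\le i,j\le n}$ denotes the $(n+1)\times(n+1)$ Hankel determinant; in the claim the sequences are indexed by $k\ge0$. The Euler polynomials are defined by $\frac{2e^{xt}}{e^t+1}=\sum_{n\ge0}E_n(x)\frac{t^n}{n!}$. -}

module Defs where

open import Algebra.Bundles using (CommutativeRing)
open import Data.Fin.Base using (Fin; zero; suc; toℕ; punchIn)
open import Data.Integer.Base using (+_)
open import Data.List.Base as List using (List; []; _∷_; replicate; _++_)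
open import Data.Nat.Base as ℕ using (ℕ; zero; suc; _∸_; _!)
open import Data.Nat.Properties using (_!≢0)
open import Data.Rational.Base
open import Data.Rational.Properties
import Data.Rational.Unnormalised.Base as ℚᵘ
import Data.Rational.Unnormalised.Properties as ℚᵘ
open import Data.Vec.Functional as Vector using (Vector)
open import Relation.Binary.PropositionalEquality
  using (_≡_; refl; sym; trans; cong; cong₂; module ≡-Reasoning)

open import Algebra.Definitions.RawSemiring +-*-rawSemiring public
  using (sum; _^_)

------------------------------------------------------------------------
-- Hankel determinants

Matrix : ℕ → Set
Matrix n = Fin n → Fin n → ℚ

-- Laplace expansion along the first row.
det : ∀ {n} → Matrix n → ℚ
det {zero}  M = 1ℚ
det {suc n} M =
  sum λ j → (- 1ℚ) ^ toℕ j * M zero j * det (λ i k → M (suc i) (punchIn j k))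

-- H n is the determinant of size n + 1, not n.
H : ℕ → (ℕ → ℚ) → ℚ
H n a = det {suc n} λ i j → a (toℕ i ℕ.+ toℕ j)

------------------------------------------------------------------------
-- Factorials in ℚ

fact⁻¹ : ℕ → ℚ
fact⁻¹ n = (+ 1 / (n !)) {{n !≢0}}

fact : ℕ → ℚ
fact n = + (n !) / 1

------------------------------------------------------------------------
-- Polynomials over ℚ

-- Coefficients, constant term first. Trailing zeros are allowed, so equality
-- of polynomials is equality of all coefficients, not _≡_ on lists.
Poly : Set
Poly = List ℚ

coeff : Poly → ℕ → ℚ
coeff []      _       = 0ℚ
coeff (a ∷ p) zero    = a
coeff (a ∷ p) (suc m) = coeff p m

infix 4 _≈ᴾ_
_≈ᴾ_ : Poly → Poly → Set
p ≈ᴾ q = ∀ m → coeff p m ≡ coeff q m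

infixl 6 _+ᴾ_
_+ᴾ_ : Poly → Poly → Poly
[]      +ᴾ q       = q
(a ∷ p) +ᴾ []      = a ∷ p
(a ∷ p) +ᴾ (b ∷ q) = (a + b) ∷ (p +ᴾ q)

infixr 7 _·ᴾ_
_·ᴾ_ : ℚ → Poly → Poly
c ·ᴾ p = List.map (c *_) p

sumᴾ : ∀ {n} → Vector Poly n → Poly
sumᴾ = Vector.foldr _+ᴾ_ []

x^_ : ℕ → Poly
x^ n = replicate n 0ℚ ++ 1ℚ ∷ []

eval : Poly → ℚ → ℚ
eval []      x = 0ℚ
eval (a ∷ p) x = a + x * eval p x

------------------------------------------------------------------------
-- Formal power series in t, as sequences of coefficients

infixl 7 _⊛_
_⊛_ : (ℕ → ℚ) → (ℕ → Poly) → (ℕ → Poly)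
(g ⊛ h) n = sumᴾ {suc n} λ i → g (toℕ i) ·ᴾ h (n ∸ toℕ i)

-- f ÷ˢ g is the series h with g ⊛ h = f, obtained by solving for hₙ in
-- fₙ = g₀ hₙ + Σ_{i<n} gᵢ₊₁ hₙ₋₁₋ᵢ ; previous f g n lists hₙ₋₁ , … , h₀.
module _ (f : ℕ → Poly) (g : ℕ → ℚ) .{{_ : NonZero (g 0)}} where

  infixl 7 _÷ˢ_
  _÷ˢ_     : ℕ → Poly
  previous : ∀ n → Vector Poly n

  _÷ˢ_ n =
    (1/ g 0) ·ᴾ (f n +ᴾ (- 1ℚ) ·ᴾ sumᴾ λ i → g (suc (toℕ i)) ·ᴾ previous n i)

  previous zero    ()
  previous (suc n) zero    = _÷ˢ_ n
  previous (suc n) (suc i) = previous n i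

-- e^t + 1
exp+1 : ℕ → ℚ
exp+1 zero    = fact⁻¹ 0 + 1ℚ
exp+1 (suc n) = fact⁻¹ (suc n)

-- 2 e^{xt}
2exp[x] : ℕ → Poly
2exp[x] n = (1ℚ + 1ℚ) ·ᴾ fact⁻¹ n ·ᴾ (x^ n)

-- The Euler polynomial Eₙ is n! times the coefficient of tⁿ in
-- 2 e^{xt} / (e^t + 1).
E : ℕ → Poly
E n = fact n ·ᴾ (2exp[x] ÷ˢ exp+1) n

------------------------------------------------------------------------
-- The generating function identity
--   (e^t + 1) Σ Eₙ(x) tⁿ/n! = 2 e^{xt}   in ℚ[x][[t]].

coeff-+ : ∀ p q m → coeff (p +ᴾ q) m ≡ coeff p m + coeff q m
coeff-+ []      q       m       = sym (+-identityˡ _)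
coeff-+ (a ∷ p) []      m       = sym (+-identityʳ _)
coeff-+ (a ∷ p) (b ∷ q) zero    = refl
coeff-+ (a ∷ p) (b ∷ q) (suc m) = coeff-+ p q m

coeff-· : ∀ c p m → coeff (c ·ᴾ p) m ≡ c * coeff p m
coeff-· c []      m       = sym (*-zeroʳ c)
coeff-· c (a ∷ p) zero    = refl
coeff-· c (a ∷ p) (suc m) = coeff-· c p m

sumᴾ-cong : ∀ {n} (u v : Vector Poly n) →
            (∀ i → u i ≈ᴾ v i) → sumᴾ u ≈ᴾ sumᴾ v
sumᴾ-cong {zero}  u v eq m = refl
sumᴾ-cong {suc n} u v eq m =
  trans (coeff-+ (u zero) _ m)
 (trans (cong₂ _+_ (eq zero m)
                   (sumᴾ-cong (λ i → u (suc i)) (λ i → v (suc i)) (λ i → eq (suc i)) m))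
        (sym (coeff-+ (v zero) _ m)))

module _ (f : ℕ → Poly) (g : ℕ → ℚ) .{{_ : NonZero (g 0)}} where

  previous≡ : ∀ n i → previous f g n i ≡ (f ÷ˢ g) (n ∸ suc (toℕ i))
  previous≡ (suc n) zero    = refl
  previous≡ (suc n) (suc i) = previous≡ n i

  ÷ˢ-correct : ∀ n → (g ⊛ (f ÷ˢ g)) n ≈ᴾ f n
  ÷ˢ-correct n m = begin
    coeff (g 0 ·ᴾ (f ÷ˢ g) n +ᴾ R) m
      ≡⟨ coeff-+ (g 0 ·ᴾ (f ÷ˢ g) n) R m ⟩
    coeff (g 0 ·ᴾ (f ÷ˢ g) n) m + coeff R m
      ≡⟨ cong₂ _+_ head≡ (sumᴾ-cong {n} _ _ tail≡ m) ⟩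
    (coeff (f n) m + (- 1ℚ) * coeff S m) + coeff S m
      ≡⟨ +-assoc (coeff (f n) m) _ _ ⟩
    coeff (f n) m + ((- 1ℚ) * coeff S m + coeff S m)
      ≡⟨ cong (λ z → coeff (f n) m + (z + coeff S m)) (-1*x≈-x (coeff S m)) ⟩
    coeff (f n) m + (- coeff S m + coeff S m)
      ≡⟨ cong (λ z → coeff (f n) m + z) (+-inverseˡ (coeff S m)) ⟩
    coeff (f n) m + 0ℚ
      ≡⟨ +-identityʳ _ ⟩
    coeff (f n) m ∎
    where
    open ≡-Reasoning
    open import Algebra.Properties.Ring (CommutativeRing.ring +-*-commutativeRing)
      using (-1*x≈-x)
    S R : Poly
    S = sumᴾ λ i → g (suc (toℕ i)) ·ᴾ previous f g n i
    R = sumᴾ λ (i : Fin n) → g (suc (toℕ i)) ·ᴾ (f ÷ˢ g) (n ∸ suc (toℕ i))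

    tail≡ : ∀ i → (g (suc (toℕ i)) ·ᴾ (f ÷ˢ g) (n ∸ suc (toℕ i)))
                  ≈ᴾ (g (suc (toℕ i)) ·ᴾ previous f g n i)
    tail≡ i k = cong (λ p → coeff (g (suc (toℕ i)) ·ᴾ p) k) (sym (previous≡ n i))

    T : Poly
    T = f n +ᴾ (- 1ℚ) ·ᴾ S

    head≡ : coeff (g 0 ·ᴾ (f ÷ˢ g) n) m ≡ coeff (f n) m + (- 1ℚ) * coeff S m
    head≡ = begin
      coeff (g 0 ·ᴾ (1/ g 0) ·ᴾ T) m   ≡⟨ coeff-· (g 0) ((1/ g 0) ·ᴾ T) m ⟩
      g 0 * coeff ((1/ g 0) ·ᴾ T) m    ≡⟨ cong (g 0 *_) (coeff-· (1/ g 0) T m) ⟩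
      g 0 * ((1/ g 0) * coeff T m)     ≡⟨ *-assoc (g 0) (1/ g 0) (coeff T m) ⟨
      (g 0 * (1/ g 0)) * coeff T m     ≡⟨ cong (_* coeff T m) (*-inverseʳ (g 0)) ⟩
      1ℚ * coeff T m                   ≡⟨ *-identityˡ _ ⟩
      coeff T m                        ≡⟨ coeff-+ (f n) _ m ⟩
      coeff (f n) m + coeff ((- 1ℚ) ·ᴾ S) m
        ≡⟨ cong (λ z → coeff (f n) m + z) (coeff-· (- 1ℚ) S m) ⟩
      coeff (f n) m + (- 1ℚ) * coeff S m ∎

1/d*d≡1 : ∀ d .{{_ : ℕ.NonZero d}} → (+ 1 / d) * (+ d / 1) ≡ 1ℚ
1/d*d≡1 d@(suc d-1) = toℚᵘ-injective (begin
  toℚᵘ ((+ 1 / d) * (+ d / 1))          ≈⟨ toℚᵘ-homo-* (+ 1 / d) (+ d / 1) ⟩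
  toℚᵘ (+ 1 / d) ℚᵘ.* toℚᵘ (+ d / 1)
    ≈⟨ ℚᵘ.*-cong (toℚᵘ-fromℚᵘ (ℚᵘ.mkℚᵘ (+ 1) d-1)) (toℚᵘ-fromℚᵘ (ℚᵘ.mkℚᵘ (+ d) 0)) ⟩
  ℚᵘ.1/ (ℚᵘ.mkℚᵘ (+ d) 0) ℚᵘ.* ℚᵘ.mkℚᵘ (+ d) 0
    ≈⟨ ℚᵘ.*-inverseˡ (ℚᵘ.mkℚᵘ (+ d) 0) ⟩
  ℚᵘ.1ℚᵘ ∎)
  where open ℚᵘ.≃-Reasoning

fact⁻¹*fact : ∀ n → fact⁻¹ n * fact n ≡ 1ℚ
fact⁻¹*fact n = 1/d*d≡1 (n !) {{n !≢0}}

⊛-congˡ : ∀ g {h h′} → (∀ k → h k ≈ᴾ h′ k) → ∀ n → (g ⊛ h) n ≈ᴾ (g ⊛ h′) n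
⊛-congˡ g {h} {h′} eq n =
  sumᴾ-cong {suc n} (λ i → g (toℕ i) ·ᴾ h (n ∸ toℕ i)) (λ i → g (toℕ i) ·ᴾ h′ (n ∸ toℕ i))
    λ i l → trans (coeff-· (g (toℕ i)) (h (n ∸ toℕ i)) l)
           (trans (cong (g (toℕ i) *_) (eq (n ∸ toℕ i) l))
                  (sym (coeff-· (g (toℕ i)) (h′ (n ∸ toℕ i)) l)))

E-generatingFunction : ∀ n → (exp+1 ⊛ λ k → fact⁻¹ k ·ᴾ E k) n ≈ᴾ 2exp[x] n
E-generatingFunction n m =
  trans (⊛-congˡ exp+1 {λ k → fact⁻¹ k ·ᴾ E k} {2exp[x] ÷ˢ exp+1} cancel n m)
        (÷ˢ-correct 2exp[x] exp+1 n m)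
  where
  cancel : ∀ k → (fact⁻¹ k ·ᴾ E k) ≈ᴾ (2exp[x] ÷ˢ exp+1) k
  cancel k l =
    trans (coeff-· (fact⁻¹ k) (E k) l)
   (trans (cong (fact⁻¹ k *_) (coeff-· (fact k) Q l))
   (trans (sym (*-assoc (fact⁻¹ k) (fact k) (coeff Q l)))
   (trans (cong (_* coeff Q l) (fact⁻¹*fact k)) (*-identityˡ _))))
    where
    Q : Poly
    Q = (2exp[x] ÷ˢ exp+1) k

{-# OPTIONS --safe #-}

-- Put f(t) = Σ Eₖ(1) tᵏ/k! = 2eᵗ/(eᵗ + 1). If N/D is the [n/n+1] Padé approximant
-- of eᵗ, so that eᵗ D = N + O(t²ⁿ⁺²), then Q = N + D satisfies
-- (eᵗ + 1)(Q f - 2N) = 2eᵗ(N + D) - 2(eᵗ + 1)N = O(t²ⁿ⁺²), hence Q f = 2N + O(t²ⁿ⁺²).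
-- The coefficients of Q f in degrees n+1, …, 2n+1 therefore vanish, which is a linear
-- relation between columns 0, …, n+1 of the matrix (aᵢ₊ⱼ). Substituting it for column
-- n+1 shows that the two Hankel determinants are in the ratio of the extreme
-- coefficients of (2n+1)! Q, namely 2 (2n+1)! and (-1)ⁿ⁺¹ n!, up to the sign (-1)ⁿ⁺¹
-- from moving column 0 past columns 1, …, n and solving for column n+1.
module Submission where

open import Algebra.Bundles using (CommutativeRing)
open import Data.Fin.Base using (Fin; zero; suc; toℕ; fromℕ; fromℕ<; inject₁; punchIn; punchOut)
open import Data.Fin.Induction using (<-weakInduction)
open import Data.Fin.Permutation using (Permutation; permutation)
import Data.Fin.Properties as Fin
import Data.Integer.Base as ℤ
import Data.Integer.Properties as ℤ
open import Data.List.Base using ([]; _∷_)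
open import Data.Nat.Base as ℕ using (ℕ; zero; suc; _∸_; _≥_; z≤n; s≤s; _!)
open import Data.Nat.Combinatorics
  using (_C_; nCk≡n!/k![n-k]!; k![n∸k]!∣n!; k>n⇒nCk≡0; nCk+nC[k+1]≡[n+1]C[k+1])
open import Data.Nat.DivMod using (m/n*n≡m)
import Data.Nat.Properties as ℕ
open import Data.Product.Base using (_×_; _,_; ∃)
open import Data.Rational.Base using
  (ℚ; 0ℚ; 1ℚ; ½; _+_; _*_; _-_; -_; 1/_; _/_; NonZero; toℚᵘ)
open import Data.Rational.Properties
open import Data.Rational.Solver using (module +-*-Solver)
import Data.Rational.Unnormalised.Base as ℚᵘ
import Data.Rational.Unnormalised.Properties as ℚᵘ
open import Data.Sum.Base using (_⊎_; inj₁; inj₂)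
open import Data.Vec.Functional using (Vector; insertAt)
open import Data.Vec.Functional.Properties using (insertAt-lookup)
open import Function.Base using (_∘_)
open import Relation.Binary.PropositionalEquality
open import Relation.Nullary using (yes; no; contradiction)
open import Defs

open import Algebra.Properties.CommutativeMonoid.Sum
  (CommutativeRing.+-commutativeMonoid +-*-commutativeRing)
  using (sum-cong-≗; ∑-distrib-+; sum-permute)
open import Algebra.Properties.Group (CommutativeRing.+-group +-*-commutativeRing)
  using (∙-cancelʳ)
open import Algebra.Properties.Semiring.Sum (CommutativeRing.semiring +-*-commutativeRing)
  using (*-distribˡ-sum)

open +-*-Solver
open ≡-Reasoning

-- Formal power series

Series : Set
Series = ℕ → ℚ

tail : Series → Series
tail f = f ∘ suc

-- The Cauchy product by recursion on the degree: with f = f₀ + t · `tail f`, the term of f₀ is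
-- split off and the rest has lower degree.
infixl 7 _∗_
_∗_ : Series → Series → Series
(f ∗ g) zero    = f 0 * g 0
(f ∗ g) (suc n) = f 0 * g (suc n) + (tail f ∗ g) n

-- Degree n sees only coefficients up to n. The bounds matter in `∗-cancelˡ`, where agreement is
-- known only up to the current degree.
∗-cong : ∀ {f f′ g g′} n → (∀ s → s ℕ.≤ n → f s ≡ f′ s) → (∀ s → s ℕ.≤ n → g s ≡ g′ s) →
         (f ∗ g) n ≡ (f′ ∗ g′) n
∗-cong zero    p q = cong₂ _*_ (p 0 z≤n) (q 0 z≤n)
∗-cong (suc n) p q = cong₂ _+_ (cong₂ _*_ (p 0 z≤n) (q _ ℕ.≤-refl))
  (∗-cong n (λ s s≤n → p (suc s) (s≤s s≤n)) (λ s s≤n → q s (ℕ.m≤n⇒m≤1+n s≤n)))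

∗-congʳ : ∀ f {g g′} → g ≗ g′ → f ∗ g ≗ f ∗ g′
∗-congʳ f eq n = ∗-cong n (λ _ _ → refl) (λ s _ → eq s)

∗-congˡ : ∀ {f f′} g → f ≗ f′ → f ∗ g ≗ f′ ∗ g
∗-congˡ g eq n = ∗-cong n (λ s _ → eq s) (λ _ _ → refl)

-- The mirror image of the defining recursion, splitting on the right factor; together the two make
-- commutativity an induction.
∗-sucʳ : ∀ f g n → (f ∗ g) (suc n) ≡ f (suc n) * g 0 + (f ∗ tail g) n
∗-sucʳ f g zero    = +-comm (f 0 * g 1) (f 1 * g 0)
∗-sucʳ f g (suc n) = begin
  x + (tail f ∗ g) (suc n)  ≡⟨ cong (x +_) (∗-sucʳ (tail f) g n) ⟩
  x + (y + z)               ≡⟨ solve 3 (λ x y z → x :+ (y :+ z) := y :+ (x :+ z)) refl x y z ⟩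
  y + (x + z)               ∎
  where
  x = f 0 * g (suc (suc n))
  y = f (suc (suc n)) * g 0
  z = (tail f ∗ tail g) n

∗-comm : ∀ f g → f ∗ g ≗ g ∗ f
∗-comm f g zero    = *-comm (f 0) (g 0)
∗-comm f g (suc n) = trans (∗-sucʳ f g n) (cong₂ _+_ (*-comm _ (g 0)) (∗-comm f (tail g) n))

-- The form f + c g serves for sums (c = 1) and differences (c = -1) alike, which is why `1ℚ *` and
-- `(- 1ℚ) *` appear in later definitions.
∗-linearˡ : ∀ c f g h n → ((λ s → f s + c * g s) ∗ h) n ≡ (f ∗ h) n + c * (g ∗ h) n
∗-linearˡ c f g h zero    =
  solve 4 (λ c f g h → (f :+ c :* g) :* h := f :* h :+ c :* (g :* h)) refl c (f 0) (g 0) (h 0)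
∗-linearˡ c f g h (suc n) = begin
  (f 0 + c * g 0) * h (suc n) + ((λ s → tail f s + c * tail g s) ∗ h) n
    ≡⟨ cong (λ z → (f 0 + c * g 0) * h (suc n) + z) (∗-linearˡ c (tail f) (tail g) h n) ⟩
  (f 0 + c * g 0) * h (suc n) + ((tail f ∗ h) n + c * (tail g ∗ h) n)
    ≡⟨ solve 6 (λ c f g h x y → (f :+ c :* g) :* h :+ (x :+ c :* y)
                              := (f :* h :+ x) :+ c :* (g :* h :+ y)) refl
         c (f 0) (g 0) (h (suc n)) ((tail f ∗ h) n) ((tail g ∗ h) n) ⟩
  (f ∗ h) (suc n) + c * (g ∗ h) (suc n) ∎

∗-linearʳ : ∀ c f g h n → (f ∗ (λ s → g s + c * h s)) n ≡ (f ∗ g) n + c * (f ∗ h) n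
∗-linearʳ c f g h n = begin
  (f ∗ (λ s → g s + c * h s)) n ≡⟨ ∗-comm f _ n ⟩
  ((λ s → g s + c * h s) ∗ f) n ≡⟨ ∗-linearˡ c g h f n ⟩
  (g ∗ f) n + c * (h ∗ f) n     ≡⟨ cong₂ (λ x y → x + c * y) (∗-comm g f n) (∗-comm h f n) ⟩
  (f ∗ g) n + c * (f ∗ h) n     ∎

∗-zeroˡ : ∀ {f} g → (∀ s → f s ≡ 0ℚ) → ∀ n → (f ∗ g) n ≡ 0ℚ
∗-zeroˡ     g f≡0 zero    = trans (cong (_* g 0) (f≡0 0)) (*-zeroˡ (g 0))
∗-zeroˡ {f} g f≡0 (suc n) = begin
  f 0 * g (suc n) + (tail f ∗ g) n
    ≡⟨ cong₂ (λ x y → x * g (suc n) + y) (f≡0 0) (∗-zeroˡ g (f≡0 ∘ suc) n) ⟩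
  0ℚ * g (suc n) + 0ℚ  ≡⟨ +-identityʳ _ ⟩
  0ℚ * g (suc n)       ≡⟨ *-zeroˡ (g (suc n)) ⟩
  0ℚ                   ∎

const : ℚ → Series
const c zero    = c
const c (suc _) = 0ℚ

∗-constˡ : ∀ c g n → (const c ∗ g) n ≡ c * g n
∗-constˡ c g zero    = refl
∗-constˡ c g (suc n) =
  trans (cong (c * g (suc n) +_) (∗-zeroˡ g (λ _ → refl) n)) (+-identityʳ _)

shift : Series → Series
shift f zero    = 0ℚ
shift f (suc n) = f n

∗-shiftʳ : ∀ f g → f ∗ shift g ≗ shift (f ∗ g)
∗-shiftʳ f g zero          = *-zeroʳ (f 0)
∗-shiftʳ f g (suc zero)    = trans (cong (f 0 * g 0 +_) (*-zeroʳ (f 1))) (+-identityʳ _)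
∗-shiftʳ f g (suc (suc n)) = cong (f 0 * g (suc n) +_) (∗-shiftʳ (tail f) g (suc n))

∗-assoc : ∀ f g h → (f ∗ g) ∗ h ≗ f ∗ (g ∗ h)
∗-assoc f g h zero    = *-assoc (f 0) (g 0) (h 0)
∗-assoc f g h (suc n) = begin
  (f 0 * g 0) * h (suc n) + (tail (f ∗ g) ∗ h) n
    ≡⟨ cong (x +_) (∗-congˡ h (λ s → +-comm (f 0 * g (suc s)) _) n) ⟩
  x + ((λ s → (tail f ∗ g) s + f 0 * tail g s) ∗ h) n
    ≡⟨ cong (x +_) (∗-linearˡ (f 0) (tail f ∗ g) (tail g) h n) ⟩
  x + (((tail f ∗ g) ∗ h) n + f 0 * (tail g ∗ h) n)
    ≡⟨ cong (λ z → x + (z + f 0 * (tail g ∗ h) n)) (∗-assoc (tail f) g h n) ⟩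
  x + ((tail f ∗ (g ∗ h)) n + f 0 * (tail g ∗ h) n)
    ≡⟨ solve 5 (λ f g h y z → f :* g :* h :+ (y :+ f :* z) := f :* (g :* h :+ z) :+ y) refl
         (f 0) (g 0) (h (suc n)) ((tail f ∗ (g ∗ h)) n) ((tail g ∗ h) n) ⟩
  (f ∗ (g ∗ h)) (suc n) ∎
  where x = (f 0 * g 0) * h (suc n)

∗-comm-assoc : ∀ f g h → f ∗ (g ∗ h) ≗ g ∗ (f ∗ h)
∗-comm-assoc f g h n = begin
  (f ∗ (g ∗ h)) n  ≡⟨ ∗-assoc f g h n ⟨
  ((f ∗ g) ∗ h) n  ≡⟨ ∗-congˡ h (∗-comm f g) n ⟩
  ((g ∗ f) ∗ h) n  ≡⟨ ∗-assoc g f h n ⟩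
  (g ∗ (f ∗ h)) n  ∎

-- A series with invertible constant term is a unit, also modulo a power of t. Cancellation goes
-- degree by degree, so a hypothesis up to degree n suffices.
∗-cancelˡ : ∀ f .{{_ : NonZero (f 0)}} {g h} n → (∀ s → s ℕ.≤ n → (f ∗ g) s ≡ (f ∗ h) s) →
            ∀ s → s ℕ.≤ n → g s ≡ h s
∗-cancelˡ f {g} {h} n eq = λ s s≤n → below s s≤n s ℕ.≤-refl
  where
  *-cancelˡ : ∀ {x y} → f 0 * x ≡ f 0 * y → x ≡ y
  *-cancelˡ {x} {y} p = begin
    x                     ≡⟨ *-identityˡ x ⟨
    1ℚ * x                ≡⟨ cong (_* x) (*-inverseˡ (f 0)) ⟨
    1/ f 0 * f 0 * x      ≡⟨ *-assoc (1/ f 0) (f 0) x ⟩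
    1/ f 0 * (f 0 * x)    ≡⟨ cong (1/ f 0 *_) p ⟩
    1/ f 0 * (f 0 * y)    ≡⟨ *-assoc (1/ f 0) (f 0) y ⟨
    1/ f 0 * f 0 * y      ≡⟨ cong (_* y) (*-inverseˡ (f 0)) ⟩
    1ℚ * y                ≡⟨ *-identityˡ y ⟩
    y                     ∎

  below : ∀ m → m ℕ.≤ n → ∀ s → s ℕ.≤ m → g s ≡ h s
  below zero    m≤n _ z≤n = *-cancelˡ (eq 0 z≤n)
  below (suc m) m<n s s≤1+m with ℕ.m≤n⇒m<n∨m≡n s≤1+m
  ... | inj₁ (s≤s s≤m) = below m (ℕ.<⇒≤ m<n) s s≤m
  -- In the new degree the tail terms agree by induction, so only `f 0` times the top coefficient is
  -- left to compare.
  ... | inj₂ refl      = *-cancelˡ (∙-cancelʳ ((tail f ∗ h) m) _ _ (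
        trans (cong (f 0 * g (suc m) +_) (sym tails)) (eq (suc m) m<n)))
    where
    tails : (tail f ∗ g) m ≡ (tail f ∗ h) m
    tails = ∗-cong m (λ _ _ → refl) (below m (ℕ.<⇒≤ m<n))

-- Padé approximants of the exponential

ι : ℕ → ℚ
ι n = ℤ.+ n / 1

toℚᵘ-ι : ∀ n → toℚᵘ (ι n) ℚᵘ.≃ ℚᵘ.mkℚᵘ (ℤ.+ n) 0
toℚᵘ-ι n = toℚᵘ-fromℚᵘ (ℚᵘ.mkℚᵘ (ℤ.+ n) 0)

ι-+ : ∀ a b → ι (a ℕ.+ b) ≡ ι a + ι b
ι-+ a b = toℚᵘ-injective (ℚᵘ.≃-trans (toℚᵘ-ι (a ℕ.+ b))
  (ℚᵘ.≃-trans (ℚᵘ.*≡* (cong (ℤ._* ℤ.+ 1) (sym numerator)))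
  (ℚᵘ.≃-sym (ℚᵘ.≃-trans (toℚᵘ-homo-+ (ι a) (ι b)) (ℚᵘ.+-cong (toℚᵘ-ι a) (toℚᵘ-ι b))))))
  where
  numerator : ℤ.+ a ℤ.* ℤ.+ 1 ℤ.+ ℤ.+ b ℤ.* ℤ.+ 1 ≡ ℤ.+ (a ℕ.+ b)
  numerator = cong₂ ℤ._+_ (ℤ.*-identityʳ (ℤ.+ a)) (ℤ.*-identityʳ (ℤ.+ b))

ι-* : ∀ a b → ι (a ℕ.* b) ≡ ι a * ι b
ι-* a b = toℚᵘ-injective (ℚᵘ.≃-trans (toℚᵘ-ι (a ℕ.* b))
  (ℚᵘ.≃-trans (ℚᵘ.*≡* (cong (ℤ._* ℤ.+ 1) (ℤ.pos-* a b)))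
  (ℚᵘ.≃-sym (ℚᵘ.≃-trans (toℚᵘ-homo-* (ι a) (ι b)) (ℚᵘ.*-cong (toℚᵘ-ι a) (toℚᵘ-ι b))))))

nCk*k![n∸k]!≡n! : ∀ {n k} → k ℕ.≤ n → (n C k) ℕ.* (k ! ℕ.* (n ∸ k) !) ≡ n !
nCk*k![n∸k]!≡n! {n} {k} k≤n =
  trans (cong (ℕ._* (k ! ℕ.* (n ∸ k) !)) (nCk≡n!/k![n-k]! k≤n)) (m/n*n≡m (k![n∸k]!∣n! k≤n))
  where instance _ = k ℕ.!* (n ∸ k) !≢0

fact⁻¹*fact-C : ∀ s r → fact⁻¹ s * fact (s ℕ.+ r) ≡ fact r * ι ((s ℕ.+ r) C s)
fact⁻¹*fact-C s r = begin
  fact⁻¹ s * fact (s ℕ.+ r)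
    ≡⟨ cong (λ z → fact⁻¹ s * ι z) (nCk*k![n∸k]!≡n! (ℕ.m≤m+n s r)) ⟨
  fact⁻¹ s * ι (c ℕ.* (s ! ℕ.* (s ℕ.+ r ∸ s) !))
    ≡⟨ cong (λ z → fact⁻¹ s * ι (c ℕ.* (s ! ℕ.* z !))) (ℕ.m+n∸m≡n s r) ⟩
  fact⁻¹ s * ι (c ℕ.* (s ! ℕ.* r !))
    ≡⟨ cong (fact⁻¹ s *_) (trans (ι-* c (s ! ℕ.* r !)) (cong (ι c *_) (ι-* (s !) (r !)))) ⟩
  fact⁻¹ s * (ι c * (fact s * fact r))
    ≡⟨ solve 4 (λ u c v w → u :* (c :* (v :* w)) := (u :* v) :* (w :* c)) refl
         (fact⁻¹ s) (ι c) (fact s) (fact r) ⟩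
  (fact⁻¹ s * fact s) * (fact r * ι c)  ≡⟨ cong (_* (fact r * ι c)) (fact⁻¹*fact s) ⟩
  1ℚ * (fact r * ι c)                   ≡⟨ *-identityˡ (fact r * ι c) ⟩
  fact r * ι c ∎
  where c = (s ℕ.+ r) C s

-- The denominator of the [k/m] Padé approximant of eᵗ, scaled to have constant term
-- (k + m)!: its coefficients are (-1)ˢ (m C s) (k + m ∸ s)!.
padéDenominator : ℕ → ℕ → Series
padéDenominator k zero    = const (fact k)
padéDenominator k (suc m) s =
  padéDenominator (suc k) m s + (- 1ℚ) * shift (padéDenominator k m) s

-- Only the coefficients of degree ≤ k + m are controlled, whence r = k + m - s ≥ 0.
padé : ∀ k m s r → s ℕ.+ r ≡ k ℕ.+ m → (fact⁻¹ ∗ padéDenominator k m) s ≡ fact r * ι (k C s)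
padé k zero s r eq = begin
  (fact⁻¹ ∗ const (fact k)) s  ≡⟨ ∗-comm fact⁻¹ (const (fact k)) s ⟩
  (const (fact k) ∗ fact⁻¹) s  ≡⟨ ∗-constˡ (fact k) fact⁻¹ s ⟩
  fact k * fact⁻¹ s            ≡⟨ *-comm (fact k) (fact⁻¹ s) ⟩
  fact⁻¹ s * fact k
    ≡⟨ subst (λ z → fact⁻¹ s * fact z ≡ fact r * ι (z C s)) (trans eq (ℕ.+-identityʳ k))
         (fact⁻¹*fact-C s r) ⟩
  fact r * ι (k C s)           ∎
padé k (suc m) s r eq = begin
  (fact⁻¹ ∗ padéDenominator k (suc m)) s
    ≡⟨ ∗-linearʳ (- 1ℚ) fact⁻¹ (padéDenominator (suc k) m) (shift (padéDenominator k m)) s ⟩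
  (fact⁻¹ ∗ padéDenominator (suc k) m) s + (- 1ℚ) * (fact⁻¹ ∗ shift (padéDenominator k m)) s
    ≡⟨ cong₂ (λ x y → x + (- 1ℚ) * y) (padé (suc k) m s r (trans eq (ℕ.+-suc k m)))
         (∗-shiftʳ fact⁻¹ (padéDenominator k m) s) ⟩
  fact r * ι (suc k C s) + (- 1ℚ) * shift (fact⁻¹ ∗ padéDenominator k m) s
    ≡⟨ pascal s eq ⟩
  fact r * ι (k C s) ∎
  where
  -- The recurrence of the denominators becomes Pascal's rule for the numerators. Shifting lowers s
  -- and the total degree together, so r, and with it `fact r`, is the same in both terms.
  pascal : ∀ s → s ℕ.+ r ≡ k ℕ.+ suc m →
           fact r * ι (suc k C s) + (- 1ℚ) * shift (fact⁻¹ ∗ padéDenominator k m) s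
             ≡ fact r * ι (k C s)
  pascal zero    _ = +-identityʳ (fact r * 1ℚ)
  pascal (suc s) eq = begin
    fact r * ι (suc k C suc s) + (- 1ℚ) * (fact⁻¹ ∗ padéDenominator k m) s
      ≡⟨ cong₂ (λ x y → fact r * x + (- 1ℚ) * y)
           (trans (cong ι (sym (nCk+nC[k+1]≡[n+1]C[k+1] k s))) (ι-+ (k C s) (k C suc s)))
           (padé k m s r (ℕ.suc-injective (trans eq (ℕ.+-suc k m)))) ⟩
    fact r * (ι (k C s) + ι (k C suc s)) + (- 1ℚ) * (fact r * ι (k C s))
      ≡⟨ solve 3 (λ f x y → f :* (x :+ y) :+ con (- 1ℚ) :* (f :* x) := f :* y) refl
           (fact r) (ι (k C s)) (ι (k C suc s)) ⟩
    fact r * ι (k C suc s) ∎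

padéDenominator-zero : ∀ k m → padéDenominator k m 0 ≡ fact (k ℕ.+ m)
padéDenominator-zero k zero    = cong fact (sym (ℕ.+-identityʳ k))
padéDenominator-zero k (suc m) = begin
  padéDenominator (suc k) m 0 + 0ℚ  ≡⟨ +-identityʳ _ ⟩
  padéDenominator (suc k) m 0       ≡⟨ padéDenominator-zero (suc k) m ⟩
  fact (suc (k ℕ.+ m))              ≡⟨ cong fact (ℕ.+-suc k m) ⟨
  fact (k ℕ.+ suc m)                ∎

padéDenominator-degree : ∀ k m s → m ℕ.< s → padéDenominator k m s ≡ 0ℚ
padéDenominator-degree k zero    (suc s) _         = refl
padéDenominator-degree k (suc m) (suc s) (s≤s m<s) =
  cong₂ (λ x y → x + (- 1ℚ) * y) (padéDenominator-degree (suc k) m (suc s) (ℕ.m≤n⇒m≤1+n m<s))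
                                 (padéDenominator-degree k m s m<s)

padéDenominator-leading : ∀ k m → padéDenominator k m m ≡ (- 1ℚ) ^ m * fact k
padéDenominator-leading k zero    = sym (*-identityˡ (fact k))
padéDenominator-leading k (suc m) = begin
  padéDenominator (suc k) m (suc m) + (- 1ℚ) * padéDenominator k m m
    ≡⟨ cong₂ (λ x y → x + (- 1ℚ) * y) (padéDenominator-degree (suc k) m (suc m) ℕ.≤-refl)
                                      (padéDenominator-leading k m) ⟩
  0ℚ + (- 1ℚ) * ((- 1ℚ) ^ m * fact k)  ≡⟨ +-identityˡ _ ⟩
  (- 1ℚ) * ((- 1ℚ) ^ m * fact k)       ≡⟨ *-assoc (- 1ℚ) ((- 1ℚ) ^ m) (fact k) ⟨
  (- 1ℚ) ^ suc m * fact k              ∎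

-- The generating function of Eₖ(1)/k!

eval-+ᴾ : ∀ p q x → eval (p +ᴾ q) x ≡ eval p x + eval q x
eval-+ᴾ []      q       x = sym (+-identityˡ _)
eval-+ᴾ (a ∷ p) []      x = sym (+-identityʳ _)
eval-+ᴾ (a ∷ p) (b ∷ q) x = begin
  a + b + x * eval (p +ᴾ q) x        ≡⟨ cong (λ z → a + b + x * z) (eval-+ᴾ p q x) ⟩
  a + b + x * (eval p x + eval q x)
    ≡⟨ solve 5 (λ a b x p q → a :+ b :+ x :* (p :+ q) := a :+ x :* p :+ (b :+ x :* q)) refl
         a b x (eval p x) (eval q x) ⟩
  a + x * eval p x + (b + x * eval q x) ∎

eval-·ᴾ : ∀ c p x → eval (c ·ᴾ p) x ≡ c * eval p x
eval-·ᴾ c []      x = sym (*-zeroʳ c)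
eval-·ᴾ c (a ∷ p) x = trans (cong (λ z → c * a + x * z) (eval-·ᴾ c p x))
  (solve 4 (λ c a x p → c :* a :+ x :* (c :* p) := c :* (a :+ x :* p)) refl c a x (eval p x))

-- Lists equal as polynomials may differ in length; in the mixed cases the surplus coefficients are
-- zero and contribute nothing.
eval-cong : ∀ p q x → p ≈ᴾ q → eval p x ≡ eval q x
eval-cong []      []      x eq = refl
eval-cong []      (b ∷ q) x eq =
  trans (solve 1 (λ x → con 0ℚ := con 0ℚ :+ x :* con 0ℚ) refl x)
        (cong₂ (λ y z → y + x * z) (eq 0) (eval-cong [] q x (eq ∘ suc)))
eval-cong (a ∷ p) []      x eq =
  trans (cong₂ (λ y z → y + x * z) (eq 0) (eval-cong p [] x (eq ∘ suc)))
        (solve 1 (λ x → con 0ℚ :+ x :* con 0ℚ := con 0ℚ) refl x)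
eval-cong (a ∷ p) (b ∷ q) x eq = cong₂ (λ y z → y + x * z) (eq 0) (eval-cong p q x (eq ∘ suc))

-- Evaluation at x carries products in ℚ[x][[t]] to products in ℚ[[t]]; both sides split off the
-- same first summand.
eval-⊛ : ∀ g h x n → eval ((g ⊛ h) n) x ≡ (g ∗ λ k → eval (h k) x) n
eval-⊛ g h x zero    = trans (eval-+ᴾ (g 0 ·ᴾ h 0) [] x)
  (trans (+-identityʳ _) (eval-·ᴾ (g 0) (h 0) x))
eval-⊛ g h x (suc n) = trans (eval-+ᴾ (g 0 ·ᴾ h (suc n)) ((tail g ⊛ h) n) x)
  (cong₂ _+_ (eval-·ᴾ (g 0) (h (suc n)) x) (eval-⊛ (tail g) h x n))

eval-x^-1 : ∀ n → eval (x^ n) 1ℚ ≡ 1ℚ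
eval-x^-1 zero    = refl
eval-x^-1 (suc n) = trans (+-identityˡ _) (trans (*-identityˡ _) (eval-x^-1 n))

-- The factors stand in the order of the theorem, so that `H n euler` and `H n (tail euler)` are its
-- two determinants by definition.
euler : Series
euler k = eval (E k) 1ℚ * fact⁻¹ k

exp+1∗euler : ∀ n → (exp+1 ∗ euler) n ≡ fact⁻¹ n + 1ℚ * fact⁻¹ n
exp+1∗euler n = begin
  (exp+1 ∗ euler) n
    ≡⟨ ∗-congʳ exp+1 (λ k → trans (*-comm _ (fact⁻¹ k)) (sym (eval-·ᴾ (fact⁻¹ k) (E k) 1ℚ))) n ⟩
  (exp+1 ∗ λ k → eval (fact⁻¹ k ·ᴾ E k) 1ℚ) n
    ≡⟨ eval-⊛ exp+1 (λ k → fact⁻¹ k ·ᴾ E k) 1ℚ n ⟨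
  eval ((exp+1 ⊛ λ k → fact⁻¹ k ·ᴾ E k) n) 1ℚ
    ≡⟨ eval-cong ((exp+1 ⊛ λ k → fact⁻¹ k ·ᴾ E k) n) (2exp[x] n) 1ℚ (E-generatingFunction n) ⟩
  eval (2exp[x] n) 1ℚ
    ≡⟨ eval-·ᴾ (1ℚ + 1ℚ) (fact⁻¹ n ·ᴾ (x^ n)) 1ℚ ⟩
  (1ℚ + 1ℚ) * eval (fact⁻¹ n ·ᴾ (x^ n)) 1ℚ
    ≡⟨ cong ((1ℚ + 1ℚ) *_)
         (trans (eval-·ᴾ (fact⁻¹ n) (x^ n) 1ℚ) (cong (fact⁻¹ n *_) (eval-x^-1 n))) ⟩
  (1ℚ + 1ℚ) * (fact⁻¹ n * 1ℚ)
    ≡⟨ solve 1 (λ x → con (1ℚ + 1ℚ) :* (x :* con 1ℚ) := x :+ con 1ℚ :* x) refl (fact⁻¹ n) ⟩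
  fact⁻¹ n + 1ℚ * fact⁻¹ n ∎

exp+1∗ : ∀ f n → (exp+1 ∗ f) n ≡ (fact⁻¹ ∗ f) n + f n
exp+1∗ f n = begin
  (exp+1 ∗ f) n                                  ≡⟨ ∗-congˡ f split n ⟩
  ((λ s → fact⁻¹ s + 1ℚ * const 1ℚ s) ∗ f) n     ≡⟨ ∗-linearˡ 1ℚ fact⁻¹ (const 1ℚ) f n ⟩
  (fact⁻¹ ∗ f) n + 1ℚ * (const 1ℚ ∗ f) n
    ≡⟨ cong ((fact⁻¹ ∗ f) n +_)
         (trans (*-identityˡ _) (trans (∗-constˡ 1ℚ f n) (*-identityˡ (f n)))) ⟩
  (fact⁻¹ ∗ f) n + f n                           ∎
  where
  split : exp+1 ≗ (λ s → fact⁻¹ s + 1ℚ * const 1ℚ s)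
  split zero    = refl
  split (suc s) = sym (+-identityʳ (fact⁻¹ (suc s)))

-- The polynomial N + D and the gap in its product with the Euler series

module _ (n : ℕ) where

  -- N and D are scaled by (2n+1)!.
  D N Q : Series
  D   = padéDenominator n (suc n)
  N s = fact (n ℕ.+ suc n ∸ s) * ι (n C s)
  Q s = N s + 1ℚ * D s

  exp∗D : ∀ s → s ℕ.≤ n ℕ.+ suc n → (fact⁻¹ ∗ D) s ≡ N s
  exp∗D s s≤ = padé n (suc n) s _ (ℕ.m+[n∸m]≡n s≤)

  exp+1∗Q∗euler : ∀ s → s ℕ.≤ n ℕ.+ suc n →
                  (exp+1 ∗ (Q ∗ euler)) s ≡ (exp+1 ∗ λ s → N s + 1ℚ * N s) s
  exp+1∗Q∗euler s s≤ = begin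
    (exp+1 ∗ (Q ∗ euler)) s   ≡⟨ ∗-comm-assoc exp+1 Q euler s ⟩
    (Q ∗ (exp+1 ∗ euler)) s   ≡⟨ ∗-congʳ Q exp+1∗euler s ⟩
    (Q ∗ λ k → fact⁻¹ k + 1ℚ * fact⁻¹ k) s  ≡⟨ ∗-linearʳ 1ℚ Q fact⁻¹ fact⁻¹ s ⟩
    (Q ∗ fact⁻¹) s + 1ℚ * (Q ∗ fact⁻¹) s
      -- The Padé property replaces the exponential times D by N; this is where the bound on s is
      -- needed.
      ≡⟨ cong (λ z → z + 1ℚ * z) (trans (∗-comm Q fact⁻¹ s)
           (trans (∗-linearʳ 1ℚ fact⁻¹ N D s) (cong (λ z → (fact⁻¹ ∗ N) s + 1ℚ * z) (exp∗D s s≤)))) ⟩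
    y + 1ℚ * N s + 1ℚ * (y + 1ℚ * N s)
      ≡⟨ solve 2 (λ y z → y :+ con 1ℚ :* z :+ con 1ℚ :* (y :+ con 1ℚ :* z)
                       := y :+ con 1ℚ :* y :+ (z :+ con 1ℚ :* z)) refl y (N s) ⟩
    y + 1ℚ * y + (N s + 1ℚ * N s)
      ≡⟨ cong (_+ (N s + 1ℚ * N s)) (∗-linearʳ 1ℚ fact⁻¹ N N s) ⟨
    (fact⁻¹ ∗ λ s → N s + 1ℚ * N s) s + (N s + 1ℚ * N s)
      ≡⟨ exp+1∗ (λ s → N s + 1ℚ * N s) s ⟨
    (exp+1 ∗ λ s → N s + 1ℚ * N s) s ∎
    where y = (fact⁻¹ ∗ N) s

  N-degree : ∀ s → n ℕ.< s → N s ≡ 0ℚ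
  N-degree s n<s = trans (cong (λ z → c * ι z) (k>n⇒nCk≡0 n<s)) (*-zeroʳ c)
    where c = fact (n ℕ.+ suc n ∸ s)

  -- Cancelling the unit `exp+1` leaves Q f = 2N up to degree 2n+1, and N has degree at most n.
  Q∗euler≡0 : ∀ s → n ℕ.< s → s ℕ.≤ n ℕ.+ suc n → (Q ∗ euler) s ≡ 0ℚ
  Q∗euler≡0 s n<s s≤ = trans (∗-cancelˡ exp+1 (n ℕ.+ suc n) exp+1∗Q∗euler s s≤)
    (cong (λ z → z + 1ℚ * z) (N-degree s n<s))

  Q-degree : ∀ s → suc n ℕ.< s → Q s ≡ 0ℚ
  Q-degree s n<s = cong₂ (λ x y → x + 1ℚ * y)
    (N-degree s (ℕ.<⇒≤ n<s)) (padéDenominator-degree n (suc n) s n<s)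

  Q-zero : Q 0 ≡ fact (n ℕ.+ suc n) + fact (n ℕ.+ suc n)
  Q-zero = cong₂ _+_ (*-identityʳ (fact (n ℕ.+ suc n)))
    (trans (*-identityˡ _) (padéDenominator-zero n (suc n)))

  Q-leading : Q (suc n) ≡ (- 1ℚ) ^ suc n * fact n
  Q-leading = trans
    (cong₂ (λ x y → x + 1ℚ * y)
      (N-degree (suc n) ℕ.≤-refl) (padéDenominator-leading n (suc n)))
    (trans (+-identityˡ _) (*-identityˡ _))

-- Determinants

minor : ∀ {n} → Matrix (suc n) → Fin (suc n) → Matrix n
minor M j i k = M (suc i) (punchIn j k)

det-cong : ∀ {n} {M M′ : Matrix n} → (∀ i j → M i j ≡ M′ i j) → det M ≡ det M′
det-cong {zero}  eq = refl
det-cong {suc n} eq = sum-cong-≗ λ j →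
  cong₂ _*_ (cong ((- 1ℚ) ^ toℕ j *_) (eq zero j)) (det-cong λ i k → eq (suc i) (punchIn j k))

-- In the Laplace term of column p only the entry varies, as the minor omits that column. In any
-- other term the entry is common and linearity passes by induction to the minor, where column p has
-- index `punchOut j≢p`.
det-linear : ∀ {n} p c {M A B : Matrix n} → (∀ i → M i p ≡ c * A i p + B i p) →
             (∀ i j → j ≢ p → M i j ≡ A i j) → (∀ i j → j ≢ p → M i j ≡ B i j) →
             det M ≡ c * det A + det B
det-linear {suc n} p c {M} {A} {B} at-p offᴬ offᴮ = begin
  sum (term M)                              ≡⟨ sum-cong-≗ pointwise ⟩
  sum (λ j → c * term A j + term B j)       ≡⟨ ∑-distrib-+ (λ j → c * term A j) (term B) ⟩
  sum (λ j → c * term A j) + sum (term B)   ≡⟨ cong (_+ det B) (*-distribˡ-sum c (term A)) ⟨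
  c * det A + det B                         ∎
  where
  term : Matrix (suc n) → Fin (suc n) → ℚ
  term X j = (- 1ℚ) ^ toℕ j * X zero j * det (minor X j)

  pointwise : ∀ j → term M j ≡ c * term A j + term B j
  pointwise j with j Fin.≟ p
  ... | yes refl = begin
    s * M zero p * det (minor M p)
      ≡⟨ cong (λ z → s * z * det (minor M p)) (at-p zero) ⟩
    s * (c * A zero p + B zero p) * det (minor M p)
      ≡⟨ solve 5 (λ s c a b d → s :* (c :* a :+ b) :* d := c :* (s :* a :* d) :+ s :* b :* d) refl
           s c (A zero p) (B zero p) (det (minor M p)) ⟩
    c * (s * A zero p * det (minor M p)) + s * B zero p * det (minor M p)
      ≡⟨ cong₂ (λ x y → c * (s * A zero p * x) + s * B zero p * y)
           (det-cong λ i k → offᴬ (suc i) (punchIn p k) (Fin.punchInᵢ≢i p k))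
           (det-cong λ i k → offᴮ (suc i) (punchIn p k) (Fin.punchInᵢ≢i p k)) ⟩
    c * term A p + term B p ∎
    where s = (- 1ℚ) ^ toℕ p
  ... | no j≢p = begin
    s * M zero j * det (minor M j)
      ≡⟨ cong (s * M zero j *_) (det-linear p′ c
           (λ i → subst (λ q → M (suc i) q ≡ c * A (suc i) q + B (suc i) q) (sym p≡) (at-p (suc i)))
           (λ i k k≢p′ → offᴬ (suc i) (punchIn j k) (off k≢p′))
           (λ i k k≢p′ → offᴮ (suc i) (punchIn j k) (off k≢p′))) ⟩
    s * M zero j * (c * det (minor A j) + det (minor B j))
      ≡⟨ solve 5 (λ s m c a b → s :* m :* (c :* a :+ b) := c :* (s :* m :* a) :+ s :* m :* b) refl
           s (M zero j) c (det (minor A j)) (det (minor B j)) ⟩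
    c * (s * M zero j * det (minor A j)) + s * M zero j * det (minor B j)
      ≡⟨ cong₂ (λ x y → c * (s * x * det (minor A j)) + s * y * det (minor B j))
           (offᴬ zero j j≢p) (offᴮ zero j j≢p) ⟩
    c * term A j + term B j ∎
    where
    s  = (- 1ℚ) ^ toℕ j
    p′ = punchOut j≢p
    p≡ : punchIn j p′ ≡ p
    p≡ = Fin.punchIn-punchOut j≢p
    off : ∀ {k} → k ≢ p′ → punchIn j k ≢ p
    off k≢p′ eq = k≢p′ (Fin.punchIn-injective j _ _ (trans eq (sym p≡)))

-- The adjacent transposition of positions k and k+1, by structural recursion so that it computes
-- together with `punchIn`.
swap : ∀ {n} → Fin n → Fin (suc n) → Fin (suc n)
swap zero    zero          = suc zero
swap zero    (suc zero)    = zero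
swap zero    (suc (suc j)) = suc (suc j)
swap (suc k) zero          = zero
swap (suc k) (suc j)       = suc (swap k j)

swap-involutive : ∀ {n} (k : Fin n) j → swap k (swap k j) ≡ j
swap-involutive zero    zero          = refl
swap-involutive zero    (suc zero)    = refl
swap-involutive zero    (suc (suc j)) = refl
swap-involutive (suc k) zero          = refl
swap-involutive (suc k) (suc j)       = cong suc (swap-involutive k j)

-- Deleting column j commutes with an adjacent transposition, except that a
-- transposition moving j is absorbed and changes the parity of j.
swap-punchIn : ∀ {n} (k : Fin (suc n)) (j : Fin (suc (suc n))) →
  ((∀ l → swap k (punchIn (swap k j) l) ≡ punchIn j l) ×
     (- 1ℚ) ^ toℕ (swap k j) ≡ - ((- 1ℚ) ^ toℕ j)) ⊎
  (swap k j ≡ j × ∃ λ (k′ : Fin n) → ∀ l → swap k (punchIn j l) ≡ punchIn j (swap k′ l))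
swap-punchIn zero zero       = inj₁ ((λ { zero → refl ; (suc l) → refl }) , refl)
swap-punchIn zero (suc zero) = inj₁ ((λ { zero → refl ; (suc l) → refl }) , refl)
swap-punchIn {suc n} zero (suc (suc j)) =
  inj₂ (refl , zero , λ { zero → refl ; (suc zero) → refl ; (suc (suc l)) → refl })
swap-punchIn {suc n} (suc k) zero = inj₂ (refl , k , λ l → refl)
swap-punchIn {suc n} (suc k) (suc j) with swap-punchIn k j
... | inj₁ (eq , sign) =
  inj₁ ((λ { zero → refl ; (suc l) → cong suc (eq l) }) ,
        trans (cong ((- 1ℚ) *_) sign) (sym (neg-distribʳ-* (- 1ℚ) ((- 1ℚ) ^ toℕ j))))
... | inj₂ (fixed , k′ , eq) =
  inj₂ (cong suc fixed , suc k′ , λ { zero → refl ; (suc l) → cong suc (eq l) })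

-- Reindexing the Laplace sum by the transposition pairs terms that are negatives of each other: for
-- a moved column the sign flips and the minor stays, for a fixed column the minor undergoes a
-- transposition and induction applies.
det-swap : ∀ {n} (k : Fin n) (M : Matrix (suc n)) → det (λ i j → M i (swap k j)) ≡ - det M
det-swap {suc n} k M = begin
  sum (term M′)                        ≡⟨ sum-permute (term M′) transposition ⟩
  sum (λ j → term M′ (swap k j))       ≡⟨ sum-cong-≗ negated ⟩
  sum (λ j → (- 1ℚ) * term M j)        ≡⟨ *-distribˡ-sum (- 1ℚ) (term M) ⟨
  (- 1ℚ) * det M                       ≡⟨ neg-distribˡ-* 1ℚ (det M) ⟨
  - (1ℚ * det M)                       ≡⟨ cong -_ (*-identityˡ (det M)) ⟩
  - det M                              ∎
  where
  M′ : Matrix (suc (suc n))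
  M′ i j = M i (swap k j)

  term : Matrix (suc (suc n)) → Fin (suc (suc n)) → ℚ
  term X j = (- 1ℚ) ^ toℕ j * X zero j * det (minor X j)

  transposition : Permutation (suc (suc n)) (suc (suc n))
  transposition = permutation (swap k) (swap k)
    (swap-involutive k) (swap-involutive k)

  negated : ∀ j → term M′ (swap k j) ≡ (- 1ℚ) * term M j
  negated j with swap-punchIn k j
  ... | inj₁ (eq , sign) = begin
    (- 1ℚ) ^ toℕ (swap k j) * M zero (swap k (swap k j)) * det (minor M′ (swap k j))
      ≡⟨ cong₂ (λ x y → x * M zero y * det (minor M′ (swap k j))) sign (swap-involutive k j) ⟩
    (- s) * M zero j * det (minor M′ (swap k j))
      ≡⟨ cong ((- s) * M zero j *_) (det-cong λ i l → cong (M (suc i)) (eq l)) ⟩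
    (- s) * M zero j * det (minor M j)
      ≡⟨ solve 3 (λ s m d → (:- s) :* m :* d := con (- 1ℚ) :* (s :* m :* d)) refl
           s (M zero j) (det (minor M j)) ⟩
    (- 1ℚ) * term M j ∎
    where s = (- 1ℚ) ^ toℕ j
  ... | inj₂ (fixed , k′ , eq) = begin
    term M′ (swap k j)
      ≡⟨ cong (term M′) fixed ⟩
    s * M zero (swap k j) * det (minor M′ j)
      ≡⟨ cong₂ (λ x y → s * M zero x * y) fixed
           (trans (det-cong λ i l → cong (M (suc i)) (eq l)) (det-swap k′ (minor M j))) ⟩
    s * M zero j * - det (minor M j)
      ≡⟨ solve 3 (λ s m d → s :* m :* (:- d) := con (- 1ℚ) :* (s :* m :* d)) refl
           s (M zero j) (det (minor M j)) ⟩
    (- 1ℚ) * term M j ∎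
    where s = (- 1ℚ) ^ toℕ j

-1^n-sq : ∀ n → (- 1ℚ) ^ n * (- 1ℚ) ^ n ≡ 1ℚ
-1^n-sq zero    = refl
-1^n-sq (suc n) =
  trans (solve 1 (λ s → (con (- 1ℚ) :* s) :* (con (- 1ℚ) :* s) := s :* s) refl ((- 1ℚ) ^ n))
        (-1^n-sq n)

x≡-x⇒x≡0 : ∀ {x} → x ≡ - x → x ≡ 0ℚ
x≡-x⇒x≡0 {x} eq = begin
  x              ≡⟨ solve 1 (λ x → x := con ½ :* (x :+ x)) refl x ⟩
  ½ * (x + x)    ≡⟨ cong (λ y → ½ * (x + y)) eq ⟩
  ½ * (x + - x)  ≡⟨ solve 1 (λ x → con ½ :* (x :+ (:- x)) := con 0ℚ) refl x ⟩
  0ℚ             ∎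

-- Inserting a column at a variable position

module _ {A : Set} where

  insertAt-swap : ∀ {n} (xs : Vector A n) k x j →
                  insertAt xs (suc k) x j ≡ insertAt xs (inject₁ k) x (swap k j)
  insertAt-swap xs zero    x zero          = refl
  insertAt-swap xs zero    x (suc zero)    = refl
  insertAt-swap xs zero    x (suc (suc j)) = refl
  insertAt-swap xs (suc k) x zero          = refl
  insertAt-swap xs (suc k) x (suc j)       = insertAt-swap (xs ∘ suc) k x j

  insertAt-other : ∀ {n} (xs : Vector A n) p x y j → j ≢ p → insertAt xs p x j ≡ insertAt xs p y j
  insertAt-other         xs zero    x y zero    j≢p = contradiction refl j≢p
  insertAt-other         xs zero    x y (suc j) j≢p = refl
  insertAt-other {suc n} xs (suc p) x y zero    j≢p = refl
  insertAt-other {suc n} xs (suc p) x y (suc j) j≢p =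
    insertAt-other (xs ∘ suc) p x y j (j≢p ∘ cong suc)

  -- The copy of `xs k` lands directly before the original, so the transposition exchanges equal
  -- entries.
  insertAt-duplicate : ∀ {n} (xs : Vector A n) k j →
                       insertAt xs (inject₁ k) (xs k) (swap k j) ≡ insertAt xs (inject₁ k) (xs k) j
  insertAt-duplicate xs zero    zero          = refl
  insertAt-duplicate xs zero    (suc zero)    = refl
  insertAt-duplicate xs zero    (suc (suc j)) = refl
  insertAt-duplicate xs (suc k) zero          = refl
  insertAt-duplicate xs (suc k) (suc j)       = insertAt-duplicate (xs ∘ suc) k j

-- Square matrices with n columns `L` held fixed, while the content and the position of one further
-- column vary.
insertColumn : ∀ {n} → (Fin (suc n) → Vector ℚ n) → Fin (suc n) → Vector ℚ (suc n) → Matrix (suc n)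
insertColumn L p w i = insertAt (L i) p (w i)

module _ {n} (L : Fin (suc n) → Vector ℚ n) where

  det-insertColumn-suc : ∀ k w →
                         det (insertColumn L (suc k) w) ≡ - det (insertColumn L (inject₁ k) w)
  det-insertColumn-suc k w =
    trans (det-cong λ i j → insertAt-swap (L i) k (w i) j)
          (det-swap k (insertColumn L (inject₁ k) w))

  -- Reaching position p from the front takes p adjacent transpositions, each costing a sign.
  det-insertColumn : ∀ p w → det (insertColumn L p w) ≡ (- 1ℚ) ^ toℕ p * det (insertColumn L zero w)
  det-insertColumn p w = <-weakInduction P base step p
    where
    P : Fin (suc n) → Set
    P p = det (insertColumn L p w) ≡ (- 1ℚ) ^ toℕ p * det (insertColumn L zero w)
    base : P zero
    base = sym (*-identityˡ _)
    step : ∀ k → P (inject₁ k) → P (suc k)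
    step k ih = begin
      det (insertColumn L (suc k) w)           ≡⟨ det-insertColumn-suc k w ⟩
      - det (insertColumn L (inject₁ k) w)     ≡⟨ cong -_ ih ⟩
      - ((- 1ℚ) ^ toℕ (inject₁ k) * d)         ≡⟨ cong (λ m → - ((- 1ℚ) ^ m * d)) (Fin.toℕ-inject₁ k) ⟩
      - ((- 1ℚ) ^ toℕ k * d)
        ≡⟨ solve 2 (λ s d → :- (s :* d) := (con (- 1ℚ) :* s) :* d) refl ((- 1ℚ) ^ toℕ k) d ⟩
      (- 1ℚ) ^ suc (toℕ k) * d ∎
      where d = det (insertColumn L zero w)

  -- With the copy placed next to the original, a transposition shows that the determinant is its
  -- own negative. Moving the column to the front and then to p changes only the sign.
  det-duplicate : ∀ p k → det (insertColumn L p λ i → L i k) ≡ 0ℚ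
  det-duplicate p k = begin
    det (insertColumn L p w)                         ≡⟨ det-insertColumn p w ⟩
    (- 1ℚ) ^ toℕ p * det (insertColumn L zero w)     ≡⟨ cong ((- 1ℚ) ^ toℕ p *_) first ⟩
    (- 1ℚ) ^ toℕ p * 0ℚ                              ≡⟨ *-zeroʳ ((- 1ℚ) ^ toℕ p) ⟩
    0ℚ                                               ∎
    where
    w : Vector ℚ (suc n)
    w i = L i k

    at-k : det (insertColumn L (inject₁ k) w) ≡ 0ℚ
    at-k = x≡-x⇒x≡0 (trans (sym (det-cong λ i j → insertAt-duplicate (L i) k j))
                           (det-swap k (insertColumn L (inject₁ k) w)))

    first : det (insertColumn L zero w) ≡ 0ℚ
    first = begin
      d                    ≡⟨ *-identityˡ d ⟨
      1ℚ * d               ≡⟨ cong (_* d) (-1^n-sq (toℕ (inject₁ k))) ⟨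
      s * s * d            ≡⟨ *-assoc s s d ⟩
      s * (s * d)          ≡⟨ cong (s *_) (trans (sym (det-insertColumn (inject₁ k) w)) at-k) ⟩
      s * 0ℚ               ≡⟨ *-zeroʳ s ⟩
      0ℚ                   ∎
      where
      d = det (insertColumn L zero w)
      s = (- 1ℚ) ^ toℕ (inject₁ k)

  det-insertColumn-linear : ∀ p c u v →
    det (insertColumn L p λ i → c * u i + v i)
      ≡ c * det (insertColumn L p u) + det (insertColumn L p v)
  det-insertColumn-linear p c u v = det-linear p c
    (λ i → trans (insertAt-lookup (L i) p (c * u i + v i))
                 (sym (cong₂ (λ x y → c * x + y) (insertAt-lookup (L i) p (u i))
                                                 (insertAt-lookup (L i) p (v i)))))
    (λ i → insertAt-other (L i) p _ _)
    (λ i → insertAt-other (L i) p _ _)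

-- Hankel determinants

insertAt-first : ∀ {A : Set} {n} (f : ℕ → A) (j : Fin (suc n)) →
                 insertAt (λ k → f (suc (toℕ k))) zero (f 0) j ≡ f (toℕ j)
insertAt-first f zero    = refl
insertAt-first f (suc j) = refl

insertAt-last : ∀ {A : Set} n (f : ℕ → A) (j : Fin (suc n)) →
                insertAt (λ k → f (toℕ k)) (fromℕ n) (f n) j ≡ f (toℕ j)
insertAt-last zero    f zero    = refl
insertAt-last (suc n) f zero    = refl
insertAt-last (suc n) f (suc j) = insertAt-last n (f ∘ suc) j

module _ (a : Series) (n : ℕ) where

  private
    L : Fin (suc n) → Vector ℚ n
    L i j = a (toℕ i ℕ.+ suc (toℕ j))

    -- Columns 1, …, n of (aᵢ₊ⱼ), followed by w.
    G : Vector ℚ (suc n) → ℚ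
    G w = det (insertColumn L (fromℕ n) w)

    -- The offset stands to the left of the row index, so that `suc k ℕ.+ toℕ i` reduces and `_∗_`
    -- unfolds in `G-∗`.
    column : ℕ → Vector ℚ (suc n)
    column k i = a (k ℕ.+ toℕ i)

    G-cong : ∀ {v w} → v ≗ w → G v ≡ G w
    G-cong eq = det-cong λ i j → cong (λ x → insertAt (L i) (fromℕ n) x j) (eq i)

    G-zero : G (λ _ → 0ℚ) ≡ 0ℚ
    G-zero = begin
      -- The zero column is, by computation, -1 times itself plus itself.
      G (λ _ → 0ℚ)  ≡⟨ det-insertColumn-linear L (fromℕ n) (- 1ℚ) (λ _ → 0ℚ) (λ _ → 0ℚ) ⟩
      (- 1ℚ) * G (λ _ → 0ℚ) + G (λ _ → 0ℚ)
        ≡⟨ solve 1 (λ x → con (- 1ℚ) :* x :+ x := con 0ℚ) refl (G λ _ → 0ℚ) ⟩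
      0ℚ            ∎

    G-first : G (column 0) ≡ (- 1ℚ) ^ n * H n a
    G-first = begin
      G (column 0)
        ≡⟨ det-insertColumn L (fromℕ n) (column 0) ⟩
      (- 1ℚ) ^ toℕ (fromℕ n) * det (insertColumn L zero (column 0))
        ≡⟨ cong₂ (λ m d → (- 1ℚ) ^ m * d) (Fin.toℕ-fromℕ n) (det-cong λ i j →
             trans (cong (λ x → insertAt (L i) zero x j) (cong a (sym (ℕ.+-identityʳ (toℕ i)))))
                   (insertAt-first (λ m → a (toℕ i ℕ.+ m)) j)) ⟩
      (- 1ℚ) ^ n * H n a ∎

    -- This column already occurs in `L`, at index k.
    G-interior : ∀ k → k ℕ.< n → G (column (suc k)) ≡ 0ℚ
    G-interior k k<n = trans
      (G-cong λ i → cong a (trans (ℕ.+-comm (suc k) (toℕ i))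
                                  (cong (λ m → toℕ i ℕ.+ suc m) (sym (Fin.toℕ-fromℕ< k<n)))))
      (det-duplicate L (fromℕ n) (fromℕ< k<n))

    G-last : G (column (suc n)) ≡ H n (tail a)
    G-last = det-cong λ i j → trans
      (cong (λ x → insertAt (L i) (fromℕ n) x j) (cong a (ℕ.+-comm (suc n) (toℕ i))))
      (trans (insertAt-last n (λ m → a (toℕ i ℕ.+ suc m)) j) (cong a (ℕ.+-suc (toℕ i) (toℕ j))))

    -- The argument is the combination of columns k, ..., 0 with coefficients q₀, ..., qₖ. As k ≤ n,
    -- columns k, ..., 1 are interior and vanish under `G`, one per induction step.
    G-∗ : ∀ k q → k ℕ.≤ n → (∀ s → k ℕ.< s → q s ≡ 0ℚ) →
          G (λ i → (q ∗ a) (k ℕ.+ toℕ i)) ≡ q k * G (column 0)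
    G-∗ zero q _ degree = begin
      G (λ i → (q ∗ a) (toℕ i))
        ≡⟨ G-cong (λ i → trans
             (∗-congˡ a constant (toℕ i))
             (trans (∗-constˡ (q 0) a (toℕ i)) (sym (+-identityʳ _)))) ⟩
      G (λ i → q 0 * a (toℕ i) + 0ℚ)
        ≡⟨ det-insertColumn-linear L (fromℕ n) (q 0) (column 0) (λ _ → 0ℚ) ⟩
      q 0 * G (column 0) + G (λ _ → 0ℚ)
        ≡⟨ trans (cong (q 0 * G (column 0) +_) G-zero) (+-identityʳ _) ⟩
      q 0 * G (column 0) ∎
      where
      constant : q ≗ const (q 0)
      constant zero    = refl
      constant (suc s) = degree (suc s) (s≤s z≤n)
    G-∗ (suc k) q k<n degree = begin
      G (λ i → q 0 * a (suc k ℕ.+ toℕ i) + (tail q ∗ a) (k ℕ.+ toℕ i))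
        ≡⟨ det-insertColumn-linear L (fromℕ n) (q 0) (column (suc k))
             (λ i → (tail q ∗ a) (k ℕ.+ toℕ i)) ⟩
      q 0 * G (column (suc k)) + G (λ i → (tail q ∗ a) (k ℕ.+ toℕ i))
        ≡⟨ cong₂ (λ x y → q 0 * x + y) (G-interior k k<n)
             (G-∗ k (tail q) (ℕ.<⇒≤ k<n) (λ s k<s → degree (suc s) (s≤s k<s))) ⟩
      q 0 * 0ℚ + q (suc k) * G (column 0)
        ≡⟨ trans (cong (_+ q (suc k) * G (column 0)) (*-zeroʳ (q 0))) (+-identityˡ _) ⟩
      q (suc k) * G (column 0) ∎

  -- The gap is a linear relation among columns 0, ..., n+1. Applying `G` kills the interior ones
  -- and leaves the two extreme columns, which give the two Hankel determinants.
  hankel-relation : ∀ q → (∀ s → suc n ℕ.< s → q s ≡ 0ℚ) →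
                    (∀ s → n ℕ.< s → s ℕ.≤ n ℕ.+ suc n → (q ∗ a) s ≡ 0ℚ) →
                    q 0 * H n (tail a) + q (suc n) * ((- 1ℚ) ^ n * H n a) ≡ 0ℚ
  hankel-relation q degree gap = begin
    q 0 * H n (tail a) + q (suc n) * ((- 1ℚ) ^ n * H n a)
      ≡⟨ cong₂ (λ x y → q 0 * x + q (suc n) * y) G-last G-first ⟨
    q 0 * G (column (suc n)) + q (suc n) * G (column 0)
      -- Column n+1 is not interior, so its term is kept apart and `G-∗` is applied to `tail q`.
      ≡⟨ cong (q 0 * G (column (suc n)) +_)
           (G-∗ n (tail q) ℕ.≤-refl (λ s n<s → degree (suc s) (s≤s n<s))) ⟨
    q 0 * G (column (suc n)) + G (λ i → (tail q ∗ a) (n ℕ.+ toℕ i))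
      ≡⟨ det-insertColumn-linear L (fromℕ n) (q 0) (column (suc n))
           (λ i → (tail q ∗ a) (n ℕ.+ toℕ i)) ⟨
    G (λ i → (q ∗ a) (suc n ℕ.+ toℕ i))
      -- As i runs over the rows 0, ..., n, the degree runs over exactly n+1, ..., 2n+1.
      ≡⟨ G-cong (λ i → gap (suc n ℕ.+ toℕ i) (s≤s (ℕ.m≤m+n n (toℕ i)))
           (ℕ.≤-trans (ℕ.+-monoʳ-≤ (suc n) (Fin.toℕ≤pred[n] i))
                      (ℕ.≤-reflexive (sym (ℕ.+-suc n n))))) ⟩
    G (λ _ → 0ℚ)  ≡⟨ G-zero ⟩
    0ℚ            ∎

-- Factorials and the ratio of the determinants

fact-suc : ∀ n → fact (suc n) ≡ ι (suc n) * fact n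
fact-suc n = ι-* (suc n) (n !)

-- The last factor 2(n+1) is split so that the doubled factorial is the constant term of Q, as in
-- `Q-zero`.
fact-double : ∀ n → fact (2 ℕ.* n ℕ.+ 2) ≡ ι (suc n) * (fact (n ℕ.+ suc n) + fact (n ℕ.+ suc n))
fact-double n = begin
  fact (2 ℕ.* n ℕ.+ 2)                       ≡⟨ cong fact index ⟩
  fact (suc M)                               ≡⟨ fact-suc M ⟩
  ι (suc n ℕ.+ suc n) * fact M               ≡⟨ cong (_* fact M) (ι-+ (suc n) (suc n)) ⟩
  (ι (suc n) + ι (suc n)) * fact M
    ≡⟨ solve 2 (λ x f → (x :+ x) :* f := x :* (f :+ f)) refl (ι (suc n)) (fact M) ⟩
  ι (suc n) * (fact M + fact M)              ∎
  where
  M = n ℕ.+ suc n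
  index : 2 ℕ.* n ℕ.+ 2 ≡ suc M
  index = trans (ℕ.+-comm (2 ℕ.* n) 2)
    (cong suc (trans (cong (λ z → suc (n ℕ.+ z)) (ℕ.+-identityʳ n)) (sym (ℕ.+-suc n n))))

factorial-hankel : ∀ n → fact n * H n euler
                         ≡ (fact (n ℕ.+ suc n) + fact (n ℕ.+ suc n)) * H n (tail euler)
factorial-hankel n = begin
  f * A                    ≡⟨ *-identityˡ (f * A) ⟨
  1ℚ * (f * A)             ≡⟨ cong (_* (f * A)) (-1^n-sq n) ⟨
  s * s * (f * A)
    -- The signs (-1)ⁿ⁺¹ of the leading coefficient and (-1)ⁿ of the column move multiply to -1;
    -- adding and subtracting g B exposes the left side of `hankel-relation`.
    ≡⟨ solve 4 (λ s f a b → s :* s :* (f :* a)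
                 := b :- (b :+ ((con (- 1ℚ) :* s) :* f) :* (s :* a))) refl s f A (g * B) ⟩
  g * B - (g * B + (- 1ℚ) ^ suc n * f * (s * A))
    ≡⟨ cong (λ z → g * B - z) (trans
         (cong₂ (λ x y → x * B + y * (s * A)) (sym (Q-zero n)) (sym (Q-leading n)))
         (hankel-relation euler n (Q n) (Q-degree n) (Q∗euler≡0 n))) ⟩
  g * B - 0ℚ               ≡⟨ +-identityʳ (g * B) ⟩
  g * B                    ∎
  where
  A = H n euler
  B = H n (tail euler)
  s = (- 1ℚ) ^ n
  f = fact n
  g = fact (n ℕ.+ suc n) + fact (n ℕ.+ suc n)

proposition3p6 : ∀ (n : ℕ) → n ≥ 1 →
    H n (λ k → eval (E k) 1ℚ * fact⁻¹ k)
    ≡ (fact (2 ℕ.* n ℕ.+ 2) * fact⁻¹ (n ℕ.+ 1))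
    * H n (λ k → eval (E (suc k)) 1ℚ * fact⁻¹ (suc k))
proposition3p6 n _ = begin
  A                                          ≡⟨ *-identityˡ A ⟨
  -- Inserting the inverse of (n+1)! times (n+1)! supplies the n! required by `factorial-hankel`;
  -- the remaining factor n+1 completes (2n+2)! in `fact-double`.
  1ℚ * A                                     ≡⟨ cong (_* A) (fact⁻¹*fact (suc n)) ⟨
  fact⁻¹ (suc n) * fact (suc n) * A          ≡⟨ cong (λ z → fact⁻¹ (suc n) * z * A) (fact-suc n) ⟩
  fact⁻¹ (suc n) * (ι (suc n) * fact n) * A
    ≡⟨ solve 4 (λ u x f a → u :* (x :* f) :* a := u :* x :* (f :* a)) refl
         (fact⁻¹ (suc n)) (ι (suc n)) (fact n) A ⟩
  fact⁻¹ (suc n) * ι (suc n) * (fact n * A)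
    ≡⟨ cong (fact⁻¹ (suc n) * ι (suc n) *_) (factorial-hankel n) ⟩
  fact⁻¹ (suc n) * ι (suc n) * (g * B)
    ≡⟨ solve 4 (λ u x g b → u :* x :* (g :* b) := x :* g :* u :* b) refl
         (fact⁻¹ (suc n)) (ι (suc n)) g B ⟩
  ι (suc n) * g * fact⁻¹ (suc n) * B
    ≡⟨ cong₂ (λ x m → x * fact⁻¹ m * B) (fact-double n) (ℕ.+-comm n 1) ⟨
  fact (2 ℕ.* n ℕ.+ 2) * fact⁻¹ (n ℕ.+ 1) * B ∎
  where
  A = H n euler
  B = H n (tail euler)
  g = fact (n ℕ.+ suc n) + fact (n ℕ.+ suc n)
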